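{- Let $k$ be a positive integer, and $G$ an edge-colored graph of order $n\geq 105k-24$ such that $|CN(u)\cup CN(v)|\geq n-1$ for every pair of vertices $u$ and $v$ in $V(G)$. Then $G$ contains $k$ rainbow $C_4$'s.
   Context: Graphs are finite and simple. An edge-colored graph is a graph $G$ with a map $C:E(G)\to\mathbb{N}$. For a vertex $v$, the color neighborhood $CN(v)$ is the set of colors assigned to edges incident to $v$. A subgraph is rainbow if all its edges have distinct colors. $C_4$ denotes a cycle of length 4; "$k$ rainbow $C_4$'s" means $k$ distinct rainbow cycles of length 4 (not necessarily vertex-disjoint). -}

module Defs where

open import Data.Nat using (ℕ; _≟_)
open import Data.Fin using (Fin)
open import Data.Maybe using (Maybe; just; nothing)
open import Data.List using (List; length; mapMaybe; _++_; deduplicate)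
open import Data.List.Relation.Unary.All using (All)
open import Data.List.Relation.Unary.AllPairs using (AllPairs)
open import Data.Product using (_×_; _,_; ∃; ∃-syntax)
open import Data.Sum using (_⊎_)
open import Relation.Binary.PropositionalEquality using (_≡_; _≢_)
open import Relation.Nullary using (¬_)
open import Data.List using (allFin)

-- An edge-colored simple graph on vertex set Fin n:
-- col u v ≡ nothing  means u,v are non-adjacent,
-- col u v ≡ just c   means uv is an edge with color c.
record ECGraph (n : ℕ) : Set where
  field
    col   : Fin n → Fin n → Maybe ℕ
    loopless : ∀ v → col v v ≡ nothing
    sym   : ∀ u v → col u v ≡ col v u
open ECGraph public

CN : ∀ {n} → ECGraph n → Fin n → List ℕ
CN G v = mapMaybe (col G v) (allFin _)

cardCNUnion : ∀ {n} → ECGraph n → Fin n → Fin n → ℕ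
cardCNUnion G u v = length (deduplicate Data.Nat._≟_ (CN G u ++ CN G v))

-- A 4-cycle given by an ordered 4-tuple of vertices (a,b,c,d): edges ab,bc,cd,da.
Quad : ℕ → Set
Quad n = Fin n × Fin n × Fin n × Fin n

RainbowC4 : ∀ {n} → ECGraph n → Quad n → Set
RainbowC4 G (a , b , c , d) =
  a ≢ b × a ≢ c × a ≢ d × b ≢ c × b ≢ d × c ≢ d ×
  ∃[ x ] ∃[ y ] ∃[ z ] ∃[ w ]
    (col G a b ≡ just x × col G b c ≡ just y × col G c d ≡ just z × col G d a ≡ just w
     × x ≢ y × x ≢ z × x ≢ w × y ≢ z × y ≢ w × z ≢ w)

-- Two tuples describe the same cycle iff related by the dihedral group
-- (rotations and reflections), i.e. they have the same edge set.
SameCycle : ∀ {n} → Quad n → Quad n → Set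
SameCycle (a , b , c , d) q =
  q ≡ (a , b , c , d) ⊎ q ≡ (b , c , d , a) ⊎ q ≡ (c , d , a , b) ⊎ q ≡ (d , a , b , c) ⊎
  q ≡ (a , d , c , b) ⊎ q ≡ (d , c , b , a) ⊎ q ≡ (c , b , a , d) ⊎ q ≡ (b , a , d , c)

{-# OPTIONS --safe #-}
module Submission where

-- At every vertex u choose one edge of each color and let M u be the set of vertices x for which ux
-- is not chosen. If for some u, v more than k + 3 vertices x have chosen edges ux and vx of different
-- colors, then fixing one such x and varying the opposite vertex y gives k rainbow cycles u x v y.
-- Otherwise, with g = k + 3, every union CN u ∪ CN v of at least n - 1 colors forces
-- |M u ∩ M v| ≤ g + 1, so by convexity T = ∑ |M u| is at most about n²/6 + 3 n g/2. On the other hand,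
-- outside M u ∪ M v all but g vertices x have ux and vx of the same color, while for given u and x at
-- most |M x| + 1 vertices v have this property; summing over all u, v and x gives
-- n² ≤ 3 T + n (g + 1). Hence n ≤ 11 g + 20, contrary to the bound on n.

open import Defs
open import Data.Fin using (Fin; zero; suc)
open import Data.Fin.Properties using (any?) renaming (_≟_ to _≟ᶠ_; suc-injective to suc-injectiveᶠ)
open import Data.List using (List; []; _∷_; _++_; length; map; concat; tabulate; allFin; deduplicate)
open import Data.List.Membership.Propositional using (_∈_)
open import Data.List.Membership.Propositional.Properties
  using (∈-∃++; ∈-++⁺ˡ; ∈-++⁺ʳ; ∈-++⁻; ∈-concat⁺′; ∈-tabulate⁺; ∈-deduplicate⁻)
open import Data.List.Properties using (length-++; length-map)
open import Data.List.Relation.Unary.All using (All; []; _∷_; universal)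
  renaming (lookup to lookupAll; map to mapAll)
open import Data.List.Relation.Unary.All.Properties using ()
  renaming (map⁺ to All-map⁺; mapMaybe⁺ to All-mapMaybe⁺; ++⁺ to All-++⁺)
open import Data.List.Relation.Unary.AllPairs using (AllPairs; []; _∷_)
open import Data.List.Relation.Unary.Any using (here; there)
open import Data.List.Relation.Unary.Unique.DecPropositional.Properties using (deduplicate-!)
open import Data.List.Relation.Unary.Unique.Propositional using (Unique)
open import Data.List.Relation.Unary.Unique.Propositional.Properties using () renaming (map⁺ to Unique-map⁺)
open import Data.Maybe using (Maybe; just; nothing)
open import Data.Maybe.Properties using (just-injective) renaming (≡-dec to Maybe-≡-dec)
import Data.Maybe.Relation.Unary.All as Maybe
open import Data.Nat using (ℕ; zero; suc; _+_; _*_; _∸_; _≥_; _≤_; _<_; z≤n; s≤s; NonZero; >-nonZero; _≤?_; _≟_)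
open import Data.Nat.Properties hiding (_≟_; _≤?_)
open import Data.Nat.Tactic.RingSolver using (solve-∀)
open import Data.Product using (_×_; ∃-syntax; _,_; proj₁; proj₂)
open import Data.Sum using (_⊎_; inj₁; inj₂)
open import Function using (_∘_)
open import Relation.Binary.PropositionalEquality
  using (_≡_; _≢_; refl; trans; cong; cong₂; subst; module ≡-Reasoning)
  renaming (sym to ≡-sym)
open import Relation.Nullary using (¬_; Dec; yes; no; contradiction)
open import Relation.Nullary.Decidable using (map′; _×-dec_; ¬?)
open import Relation.Unary using (Decidable)
open import Algebra.Properties.Semiring.Sum +-*-semiring
  using (sum; sum-syntax; sum-cong-≗; ∑-distrib-+; ∑-comm; *-distribˡ-sum; *-distribʳ-sum)

-- Finite sums, counting and selection over `Fin n`.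

sum-mono : ∀ {n} {f g : Fin n → ℕ} → (∀ i → f i ≤ g i) → sum f ≤ sum g
sum-mono {zero}  f≤g = z≤n
sum-mono {suc n} f≤g = +-mono-≤ (f≤g zero) (sum-mono (f≤g ∘ suc))

sum-const : ∀ n c → ∑[ i < n ] c ≡ n * c
sum-const zero    c = refl
sum-const (suc n) c = cong (c +_) (sum-const n c)

∑-distrib-+-const : ∀ {n} (f : Fin n → ℕ) c → ∑[ i < n ] (f i + c) ≡ sum f + n * c
∑-distrib-+-const {n} f c = trans (∑-distrib-+ f (λ _ → c)) (cong (sum f +_) (sum-const n c))

∑-rotate : ∀ {n} (f : Fin n → Fin n → Fin n → ℕ) →
  ∑[ u < n ] ∑[ v < n ] ∑[ x < n ] f u v x ≡ ∑[ x < n ] ∑[ u < n ] ∑[ v < n ] f u v x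
∑-rotate {n} f = trans (sum-cong-≗ (λ u → ∑-comm (f u))) (∑-comm (λ u x → ∑[ v < n ] f u v x))

length-concat-tabulate : ∀ {A : Set} {n} (K : Fin n → List A) →
  length (concat (tabulate K)) ≡ ∑[ i < n ] length (K i)
length-concat-tabulate {n = zero}  K = refl
length-concat-tabulate {n = suc n} K =
  trans (length-++ (K zero)) (cong (length (K zero) +_) (length-concat-tabulate (K ∘ suc)))

-- Cut one occurrence of the head `x` out of `ys`: since `x` does not recur in `xs`, the tail still
-- lies in what remains.
Unique-⊆⇒length≤ : ∀ {A : Set} {xs ys : List A} →
  Unique xs → (∀ {z} → z ∈ xs → z ∈ ys) → length xs ≤ length ys
Unique-⊆⇒length≤ []            xs⊆ys = z≤n
Unique-⊆⇒length≤ {xs = x ∷ xs} (x∉xs ∷ xs!) xs⊆ys with ∈-∃++ (xs⊆ys (here refl))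
... | ps , qs , refl = begin
  suc (length xs)              ≤⟨ s≤s (Unique-⊆⇒length≤ xs! xs⊆ps++qs) ⟩
  suc (length (ps ++ qs))      ≡⟨ cong suc (length-++ ps) ⟩
  suc (length ps + length qs)  ≡⟨ ≡-sym (+-suc (length ps) (length qs)) ⟩
  length ps + suc (length qs)  ≡⟨ ≡-sym (length-++ ps) ⟩
  length (ps ++ x ∷ qs)        ∎
  where
  open ≤-Reasoning
  xs⊆ps++qs : ∀ {z} → z ∈ xs → z ∈ ps ++ qs
  xs⊆ps++qs z∈xs with ∈-++⁻ ps (xs⊆ys (there z∈xs))
  ... | inj₁ z∈ps         = ∈-++⁺ˡ z∈ps
  ... | inj₂ (here refl)  = contradiction refl (lookupAll x∉xs z∈xs)
  ... | inj₂ (there z∈qs) = ∈-++⁺ʳ ps z∈qs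

ι : {P : Set} → Dec P → ℕ
ι (yes _) = 1
ι (no  _) = 0

ι-yes : {P : Set} (P? : Dec P) → P → 1 ≤ ι P?
ι-yes (yes _) p = ≤-refl
ι-yes (no ¬p) p = contradiction p ¬p

count : ∀ {n} {P : Fin n → Set} → Decidable P → ℕ
count P? = sum (λ i → ι (P? i))

select : ∀ {n} {P : Fin n → Set} (P? : Decidable P) k → k ≤ count P? →
  ∃[ xs ] (length xs ≡ k × All P xs × Unique xs)
select         P? zero    _  = [] , refl , [] , []
select {suc n} P? (suc k) le with P? zero
... | yes p =
  let xs , len , ps , xs! = select (P? ∘ suc) k (≤-pred le)
  in zero ∷ map suc xs , cong suc (trans (length-map suc xs) len) , p ∷ All-map⁺ ps
     , All-map⁺ (universal (λ _ ()) xs) ∷ Unique-map⁺ suc-injectiveᶠ xs!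
... | no _  =
  let xs , len , ps , xs! = select (P? ∘ suc) (suc k) le
  in map suc xs , trans (length-map suc xs) len , All-map⁺ ps , Unique-map⁺ suc-injectiveᶠ xs!

Subsingleton : ∀ {n} → (Fin n → Set) → Set
Subsingleton P = ∀ {i j} → P i → P j → i ≡ j

count≤1 : ∀ {n} {P : Fin n → Set} (P? : Decidable P) → Subsingleton P → count P? ≤ 1
count≤1 P? same with count P? ≤? 1
... | yes le = le
... | no  gt with select P? 2 (≰⇒> gt)
...   | x ∷ y ∷ [] , _ , px ∷ py ∷ [] , (x≢y ∷ _) ∷ _ = contradiction (same px py) x≢y

-- Pointwise, `P` is covered by its part outside `Q` together with `Q`, and `count≤1` bounds the
-- second count. `Q` will be "the chosen edge to this vertex has a given color", so that forbidding
-- a color costs one vertex.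
count-avoid : ∀ {n} {P Q : Fin n → Set} (P? : Decidable P) (Q? : Decidable Q) → Subsingleton Q →
  ∀ {k} → suc k ≤ count P? → k ≤ count (λ i → P? i ×-dec ¬? (Q? i))
count-avoid P? Q? same {k} le = +-cancelʳ-≤ 1 _ _ (begin
  k + 1                                               ≡⟨ +-comm k 1 ⟩
  suc k                                               ≤⟨ le ⟩
  count P?                                            ≤⟨ sum-mono (λ i → split (P? i) (Q? i)) ⟩
  sum (λ i → ι (P? i ×-dec ¬? (Q? i)) + ι (Q? i))     ≡⟨ ∑-distrib-+ _ (λ i → ι (Q? i)) ⟩
  count (λ i → P? i ×-dec ¬? (Q? i)) + count Q?       ≤⟨ +-monoʳ-≤ _ (count≤1 Q? same) ⟩
  count (λ i → P? i ×-dec ¬? (Q? i)) + 1              ∎)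
  where
  open ≤-Reasoning
  split : {A B : Set} (A? : Dec A) (B? : Dec B) → ι A? ≤ ι (A? ×-dec ¬? B?) + ι B?
  split (yes _) (yes _) = ≤-refl
  split (yes _) (no  _) = ≤-refl
  split (no  _) _       = z≤n

-- Choosing one edge of each color at a vertex.

record Transversal {n} (f : Fin n → Maybe ℕ) : Set where
  field
    pick      : Fin n → Maybe ℕ
    sound     : ∀ {x c} → pick x ≡ just c → f x ≡ just c
    injective : ∀ {x y c} → pick x ≡ just c → pick y ≡ just c → x ≡ y
    complete  : ∀ {x c} → f x ≡ just c → ∃[ y ] pick y ≡ just c

_≟ᵐ_ : (m m′ : Maybe ℕ) → Dec (m ≡ m′)
_≟ᵐ_ = Maybe-≡-dec _≟_

-- Induction on `n`: the entry at `zero` is picked only if its color is not yet picked in the tail.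
-- `skip` serves both remaining cases, a non-edge and a repeated color.
transversal : ∀ {n} (f : Fin n → Maybe ℕ) → Transversal f
transversal {zero}  f = record
  { pick = λ () ; sound = λ { {()} } ; injective = λ { {()} } ; complete = λ { {()} } }
transversal {suc n} f = extend (f zero) refl
  where
  open Transversal (transversal (f ∘ suc))

  skip : (∀ {c} → f zero ≡ just c → ∃[ y ] pick y ≡ just c) → Transversal f
  skip old = record
    { pick      = λ { zero → nothing ; (suc y) → pick y }
    ; sound     = λ { {suc x} → sound {x} }
    ; injective = λ { {suc x} {suc y} p q → cong suc (injective p q) }
    ; complete  = λ { {zero} p → let y , q = old p in suc y , q
                    ; {suc x} p → let y , q = complete {x} p in suc y , q } }

  extend : ∀ m → f zero ≡ m → Transversal f
  extend nothing  f₀ = skip (λ p → contradiction (trans (≡-sym f₀) p) λ ())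
  extend (just c) f₀ with any? (λ y → pick y ≟ᵐ just c)
  ... | yes (y , q) = skip (λ p → y , trans q (trans (≡-sym f₀) p))
  ... | no  new     = record
    { pick      = λ { zero → just c ; (suc y) → pick y }
    ; sound     = λ { {zero} p → trans f₀ p ; {suc x} → sound {x} }
    ; injective = λ { {zero}  {zero}  p q → refl
                    ; {zero}  {suc y} p q → contradiction (y , trans q (≡-sym p)) new
                    ; {suc x} {zero}  p q → contradiction (x , trans p (≡-sym q)) new
                    ; {suc x} {suc y} p q → cong suc (injective p q) }
    ; complete  = λ { {zero} p → zero , trans (≡-sym f₀) p
                    ; {suc x} p → let y , q = complete {x} p in suc y , q } }

-- Comparing the choices of two vertices at a third one.

missing : Maybe ℕ → ℕ
-- `nothing` covers non-neighbors, unchosen edges and the vertex itself. The value is a number so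
-- that a product of two is the indicator of membership in both missed sets.
missing nothing  = 1
missing (just _) = 0

data Agree : Maybe ℕ → Maybe ℕ → Set where
  agree : ∀ {c} → Agree (just c) (just c)

-- Not the negation of `Agree`: both relations require that both edges are chosen.
data Differ : Maybe ℕ → Maybe ℕ → Set where
  differ : ∀ {c d} → c ≢ d → Differ (just c) (just d)

agree? : ∀ m m′ → Dec (Agree m m′)
agree? nothing  _        = no λ ()
agree? (just _) nothing  = no λ ()
agree? (just c) (just d) = map′ (λ { refl → agree }) (λ { agree → refl }) (c ≟ d)

differ? : ∀ m m′ → Dec (Differ m m′)
differ? nothing  _        = no λ ()
differ? (just _) nothing  = no λ ()
differ? (just c) (just d) = map′ differ (λ { (differ c≢d) → c≢d }) (¬? (c ≟ d))

-- The contribution of a single vertex to the bound `n≤row+row`.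
missing-agree-differ : ∀ m m′ → 1 ≤ missing m + (missing m′ + (ι (agree? m m′) + ι (differ? m m′)))
missing-agree-differ nothing  _        = s≤s z≤n
missing-agree-differ (just _) nothing  = s≤s z≤n
missing-agree-differ (just c) (just d) = cases (c ≟ d)
  where
  cases : Dec (c ≡ d) → 1 ≤ ι (agree? (just c) (just d)) + ι (differ? (just c) (just d))
  cases (yes refl) = ≤-trans (ι-yes (agree? (just c) (just c)) agree) (m≤m+n _ _)
  cases (no  c≢d)  = ≤-trans (ι-yes (differ? (just c) (just d)) (differ c≢d)) (m≤n+m _ _)

-- `K` lists the colors that `u` and `v` choose towards one vertex. The normal amount is one color;
-- two need a difference, and a vertex missed by both supplies none. Summing this inequality over
-- all vertices compares the union of color neighborhoods with `n`.
Palette : Maybe ℕ → Maybe ℕ → Set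
Palette m m′ = ∃[ K ] ((∀ {c} → m ≡ just c ⊎ m′ ≡ just c → c ∈ K)
  × length K + missing m * missing m′ ≤ ι (differ? m m′) + 1)

palette : ∀ m m′ → Palette m m′
palette nothing  nothing  = [] , (λ { (inj₁ ()) ; (inj₂ ()) }) , ≤-refl
palette nothing  (just d) = d ∷ [] , (λ { (inj₁ ()) ; (inj₂ refl) → here refl }) , ≤-refl
palette (just c) nothing  = c ∷ [] , (λ { (inj₂ ()) ; (inj₁ refl) → here refl }) , ≤-refl
palette (just c) (just d) = cases (c ≟ d)
  where
  cases : Dec (c ≡ d) → Palette (just c) (just d)
  cases (yes refl) = c ∷ [] , (λ { (inj₁ refl) → here refl ; (inj₂ refl) → here refl }) , m≤n+m 1 _
  cases (no  c≢d)  = c ∷ d ∷ [] , (λ { (inj₁ refl) → here refl ; (inj₂ refl) → there (here refl) })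
    , +-monoˡ-≤ 1 (ι-yes (differ? (just c) (just d)) (differ c≢d))

-- Writing the larger number as the smaller plus `d`, the two sides differ by exactly `d * d`; the
-- case split keeps truncated subtraction exact.
2ab≤a²+b² : ∀ a b → 2 * (a * b) ≤ a * a + b * b
2ab≤a²+b² a b with ≤-total a b
... | inj₁ a≤b = subst (λ b → 2 * (a * b) ≤ a * a + b * b) (m+[n∸m]≡n a≤b) (lemma a (b ∸ a))
  where
  identity : ∀ a d → 2 * (a * (a + d)) + d * d ≡ a * a + (a + d) * (a + d)
  identity = solve-∀
  lemma : ∀ a d → 2 * (a * (a + d)) ≤ a * a + (a + d) * (a + d)
  lemma a d = subst (2 * (a * (a + d)) ≤_) (identity a d) (m≤m+n _ _)
... | inj₂ b≤a = subst (λ a → 2 * (a * b) ≤ a * a + b * b) (m+[n∸m]≡n b≤a) (lemma b (a ∸ b))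
  where
  identity : ∀ b d → 2 * ((b + d) * b) + d * d ≡ (b + d) * (b + d) + b * b
  identity = solve-∀
  lemma : ∀ b d → 2 * ((b + d) * b) ≤ (b + d) * (b + d) + b * b
  lemma b d = subst (2 * ((b + d) * b) ≤_) (identity b d) (m≤m+n _ _)

-- Double counting of missed vertices and of agreements.

module Counting {n} (r : Fin n → Fin n → Maybe ℕ) (g : ℕ)
  (few-differ : ∀ u v → count (λ x → differ? (r u x) (r v x)) ≤ g)
  (few-missed : ∀ u v → u ≢ v → ∑[ x < n ] (missing (r u x) * missing (r v x)) ≤ suc g)
  (few-agree  : ∀ u x → count (λ v → agree? (r u x) (r v x)) ≤ ∑[ v < n ] missing (r x v) + 1)
  where

  μ : Fin n → Fin n → ℕ
  μ u x = missing (r u x)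

  -- `row u` is the size of M u, while `column x` is the number of vertices that miss `x`. The two
  -- may differ at the same vertex, because choices are made separately at the two ends of an edge.
  row column : Fin n → ℕ
  row u  = ∑[ x < n ] μ u x
  column x = ∑[ u < n ] μ u x

  total : ℕ
  total = sum row

  total≡ : total ≡ sum column
  total≡ = ∑-comm μ

  common : Fin n → Fin n → ℕ
  common u v = ∑[ x < n ] (μ u x * μ v x)

  -- `few-missed` speaks of distinct vertices only; on the diagonal the trivial bound `n` is used,
  -- which costs a single extra `n` for each `u`.
  common≤ : ∀ u v → common u v ≤ n * ι (u ≟ᶠ v) + suc g
  common≤ u v with u ≟ᶠ v
  ... | no  u≢v  = ≤-trans (few-missed u v u≢v) (m≤n+m _ _)
  ... | yes refl = begin
    common u u             ≤⟨ sum-mono (λ x → bound (r u x)) ⟩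
    ∑[ x < n ] 1           ≡⟨ sum-const n 1 ⟩
    n * 1                  ≤⟨ m≤m+n _ _ ⟩
    n * 1 + suc g          ∎
    where
    open ≤-Reasoning
    bound : ∀ m → missing m * missing m ≤ 1
    bound nothing  = ≤-refl
    bound (just _) = z≤n

  ∑common≤ : ∑[ u < n ] ∑[ v < n ] common u v ≤ n * (n + n * suc g)
  ∑common≤ = begin
    ∑[ u < n ] ∑[ v < n ] common u v  ≤⟨ sum-mono inner ⟩
    ∑[ u < n ] (n + n * suc g)        ≡⟨ sum-const n _ ⟩
    n * (n + n * suc g)               ∎
    where
    open ≤-Reasoning
    inner : ∀ u → ∑[ v < n ] common u v ≤ n + n * suc g
    inner u = begin
      ∑[ v < n ] common u v                              ≤⟨ sum-mono (common≤ u) ⟩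
      ∑[ v < n ] (n * ι (u ≟ᶠ v) + suc g)                ≡⟨ ∑-distrib-+-const (λ v → n * ι (u ≟ᶠ v)) (suc g) ⟩
      ∑[ v < n ] (n * ι (u ≟ᶠ v)) + n * suc g            ≡⟨ cong (_+ n * suc g) (≡-sym (*-distribˡ-sum n (λ v → ι (u ≟ᶠ v)))) ⟩
      n * count (u ≟ᶠ_) + n * suc g
        ≤⟨ +-monoˡ-≤ _ (*-monoʳ-≤ n (count≤1 (u ≟ᶠ_) (λ p q → trans (≡-sym p) q))) ⟩
      n * 1 + n * suc g                                  ≡⟨ cong (_+ n * suc g) (*-identityʳ n) ⟩
      n + n * suc g                                      ∎

  -- Both sides count the triples (u, v, x) in which `x` is missed by `u` and by `v`.
  ∑column²≡∑common : ∑[ x < n ] (column x * column x) ≡ ∑[ u < n ] ∑[ v < n ] common u v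
  ∑column²≡∑common = begin
    ∑[ x < n ] (column x * column x)                       ≡⟨ sum-cong-≗ (λ x → *-distribʳ-sum (column x) (λ u → μ u x)) ⟩
    ∑[ x < n ] ∑[ u < n ] (μ u x * column x)             ≡⟨ sum-cong-≗ (λ x → sum-cong-≗ (λ u → *-distribˡ-sum (μ u x) (λ v → μ v x))) ⟩
    ∑[ x < n ] ∑[ u < n ] ∑[ v < n ] (μ u x * μ v x)   ≡⟨ ≡-sym (∑-rotate (λ u v x → μ u x * μ v x)) ⟩
    ∑[ u < n ] ∑[ v < n ] common u v                   ∎
    where open ≡-Reasoning

  -- `am-gm` is the tangent form of convexity, from (3a - n)² ≥ 0 and sharp at a = n/3. Up to
  -- lower-order terms, n/3 is the average column size that `n³≤` forces from below, so the tangent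
  -- is taken at the right place.
  6n·total≤ : 6 * n * total ≤ 9 * (n * (n + n * suc g)) + n * (n * n)
  6n·total≤ = begin
    6 * n * total                                      ≡⟨ cong (6 * n *_) total≡ ⟩
    6 * n * sum column                                   ≡⟨ *-distribˡ-sum (6 * n) column ⟩
    ∑[ x < n ] (6 * n * column x)                        ≤⟨ sum-mono (λ x → am-gm (column x)) ⟩
    ∑[ x < n ] (9 * (column x * column x) + n * n)         ≡⟨ ∑-distrib-+-const (λ x → 9 * (column x * column x)) (n * n) ⟩
    ∑[ x < n ] (9 * (column x * column x)) + n * (n * n)   ≡⟨ cong (_+ n * (n * n)) (≡-sym (*-distribˡ-sum 9 (λ x → column x * column x))) ⟩
    9 * ∑[ x < n ] (column x * column x) + n * (n * n)     ≡⟨ cong (λ s → 9 * s + n * (n * n)) ∑column²≡∑common ⟩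
    9 * ∑[ u < n ] ∑[ v < n ] common u v + n * (n * n) ≤⟨ +-monoˡ-≤ _ (*-monoʳ-≤ 9 ∑common≤) ⟩
    9 * (n * (n + n * suc g)) + n * (n * n)            ∎
    where
    open ≤-Reasoning
    lhs : ∀ n a → 2 * (3 * a * n) ≡ 6 * n * a
    lhs = solve-∀
    rhs : ∀ n a → 3 * a * (3 * a) + n * n ≡ 9 * (a * a) + n * n
    rhs = solve-∀
    am-gm : ∀ a → 6 * n * a ≤ 9 * (a * a) + n * n
    am-gm a = begin
      6 * n * a                  ≡⟨ ≡-sym (lhs n a) ⟩
      2 * (3 * a * n)            ≤⟨ 2ab≤a²+b² (3 * a) n ⟩
      3 * a * (3 * a) + n * n    ≡⟨ rhs n a ⟩
      9 * (a * a) + n * n        ∎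

  agrees : Fin n → Fin n → ℕ
  agrees u v = count (λ x → agree? (r u x) (r v x))

  -- With `v` summed innermost, `few-agree` applies; its bound `row x + 1` is the same for every
  -- `u`, whence the factor `n`.
  ∑agrees≤ : ∑[ u < n ] ∑[ v < n ] agrees u v ≤ n * total + n * n
  ∑agrees≤ = begin
    ∑[ u < n ] ∑[ v < n ] agrees u v
      ≡⟨ ∑-rotate (λ u v x → ι (agree? (r u x) (r v x))) ⟩
    ∑[ x < n ] ∑[ u < n ] count (λ v → agree? (r u x) (r v x))
      ≤⟨ sum-mono (λ x → sum-mono (λ u → few-agree u x)) ⟩
    ∑[ x < n ] ∑[ u < n ] (row x + 1)   ≡⟨ sum-cong-≗ (λ x → sum-const n (row x + 1)) ⟩
    ∑[ x < n ] (n * (row x + 1))        ≡⟨ ≡-sym (*-distribˡ-sum n (λ x → row x + 1)) ⟩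
    n * ∑[ x < n ] (row x + 1)          ≡⟨ cong (n *_) (∑-distrib-+-const row 1) ⟩
    n * (total + n * 1)                 ≡⟨ cong (λ s → n * (total + s)) (*-identityʳ n) ⟩
    n * (total + n)                     ≡⟨ *-distribˡ-+ n total n ⟩
    n * total + n * n                   ∎
    where open ≤-Reasoning

  n≤row+row : ∀ u v → n ≤ row u + (row v + (agrees u v + g))
  n≤row+row u v = begin
    n                                  ≡⟨ ≡-sym (*-identityʳ n) ⟩
    n * 1                              ≡⟨ ≡-sym (sum-const n 1) ⟩
    ∑[ x < n ] 1                       ≤⟨ sum-mono (λ x → missing-agree-differ (r u x) (r v x)) ⟩
    ∑[ x < n ] (μ u x + (μ v x + (α x + δ x)))
      ≡⟨ ∑-distrib-+ (μ u) (λ x → μ v x + (α x + δ x)) ⟩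
    row u + ∑[ x < n ] (μ v x + (α x + δ x))
      ≡⟨ cong (row u +_) (∑-distrib-+ (μ v) (λ x → α x + δ x)) ⟩
    row u + (row v + ∑[ x < n ] (α x + δ x))
      ≡⟨ cong (λ s → row u + (row v + s)) (∑-distrib-+ α δ) ⟩
    row u + (row v + (agrees u v + sum δ))
      ≤⟨ +-monoʳ-≤ (row u) (+-monoʳ-≤ (row v) (+-monoʳ-≤ (agrees u v) (few-differ u v))) ⟩
    row u + (row v + (agrees u v + g)) ∎
    where
    open ≤-Reasoning
    α δ : Fin n → ℕ
    α x = ι (agree? (r u x) (r v x))
    δ x = ι (differ? (r u x) (r v x))

  -- `n≤row+row` summed over all ordered pairs. Each of `row u`, `row v` and `agrees u v`
  -- contributes one copy of `n * total`.
  n³≤ : n * (n * n) ≤ n * total + (n * total + (n * total + n * n + n * (n * g)))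
  n³≤ = begin
    n * (n * n)                 ≡⟨ ≡-sym (sum-const n (n * n)) ⟩
    ∑[ u < n ] (n * n)          ≤⟨ sum-mono inner ⟩
    ∑[ u < n ] (n * row u + (total + (A u + n * g)))
      ≡⟨ ∑-distrib-+ (λ u → n * row u) (λ u → total + (A u + n * g)) ⟩
    ∑[ u < n ] (n * row u) + ∑[ u < n ] (total + (A u + n * g))
      ≡⟨ cong₂ _+_ (≡-sym (*-distribˡ-sum n row)) (∑-distrib-+ (λ _ → total) (λ u → A u + n * g)) ⟩
    n * total + (∑[ u < n ] total + ∑[ u < n ] (A u + n * g))
      ≡⟨ cong (n * total +_) (cong₂ _+_ (sum-const n total) (∑-distrib-+-const A (n * g))) ⟩
    n * total + (n * total + (sum A + n * (n * g)))
      ≤⟨ +-monoʳ-≤ (n * total) (+-monoʳ-≤ (n * total) (+-monoˡ-≤ (n * (n * g)) ∑agrees≤)) ⟩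
    n * total + (n * total + (n * total + n * n + n * (n * g))) ∎
    where
    open ≤-Reasoning
    A : Fin n → ℕ
    A u = ∑[ v < n ] agrees u v
    inner : ∀ u → n * n ≤ n * row u + (total + (A u + n * g))
    inner u = begin
      n * n             ≡⟨ ≡-sym (sum-const n n) ⟩
      ∑[ v < n ] n      ≤⟨ sum-mono (n≤row+row u) ⟩
      ∑[ v < n ] (row u + (row v + (agrees u v + g)))
        ≡⟨ ∑-distrib-+ (λ _ → row u) (λ v → row v + (agrees u v + g)) ⟩
      ∑[ v < n ] row u + ∑[ v < n ] (row v + (agrees u v + g))
        ≡⟨ cong₂ _+_ (sum-const n (row u)) (∑-distrib-+ row (λ v → agrees u v + g)) ⟩
      n * row u + (total + ∑[ v < n ] (agrees u v + g))
        ≡⟨ cong (λ s → n * row u + (total + s)) (∑-distrib-+-const (agrees u) g) ⟩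
      n * row u + (total + (A u + n * g)) ∎

  -- Doubling `n³≤` produces the term `6 * n * total`, which `6n·total≤` replaces. One cube cancels,
  -- and dividing by n² leaves 9(g + 2) + 2(g + 1) = 11g + 20.
  n≤11g+20 : .{{_ : NonZero n}} → n ≤ 11 * g + 20
  n≤11g+20 = *-cancelˡ-≤ n (*-cancelˡ-≤ n (+-cancelˡ-≤ (n * (n * n)) _ _ (begin
    n * (n * n) + n * (n * n)                                         ≡⟨ lhs (n * (n * n)) ⟩
    2 * (n * (n * n))                                                 ≤⟨ *-monoʳ-≤ 2 n³≤ ⟩
    2 * (n * total + (n * total + (n * total + n * n + n * (n * g)))) ≡⟨ mid n g total ⟩
    6 * n * total + 2 * (n * n + n * (n * g))                         ≤⟨ +-monoˡ-≤ _ 6n·total≤ ⟩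
    9 * (n * (n + n * suc g)) + n * (n * n) + 2 * (n * n + n * (n * g)) ≡⟨ rhs n g ⟩
    n * (n * n) + n * (n * (11 * g + 20))                             ∎)))
    where
    open ≤-Reasoning
    lhs : ∀ s → s + s ≡ 2 * s
    lhs = solve-∀
    mid : ∀ n g t → 2 * (n * t + (n * t + (n * t + n * n + n * (n * g)))) ≡ 6 * n * t + 2 * (n * n + n * (n * g))
    mid = solve-∀
    rhs : ∀ n g → 9 * (n * (n + n * suc g)) + n * (n * n) + 2 * (n * n + n * (n * g)) ≡ n * (n * n) + n * (n * (11 * g + 20))
    rhs = solve-∀

-- Chosen edges of a colored graph.

module Representatives {n} (G : ECGraph n) where

  module Rep u = Transversal (transversal (col G u))

  -- Not symmetric in general: an edge may be chosen at one end only. If it is chosen at both ends,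
  -- the two entries carry the same color.
  rep : Fin n → Fin n → Maybe ℕ
  rep = Rep.pick

  -- By `complete`, no color at `u` is lost in passing to chosen edges, so the union hypothesis can
  -- be read off from `rep` alone.
  CN-rep : ∀ u → All (λ c → ∃[ x ] rep u x ≡ just c) (CN G u)
  CN-rep u = All-mapMaybe⁺ (All-map⁺ (universal (λ x → picked (col G u x) refl) (allFin n)))
    where
    picked : ∀ {x} m → col G u x ≡ m → Maybe.All (λ c → ∃[ y ] rep u y ≡ just c) m
    picked nothing  _ = Maybe.nothing
    picked (just c) p = Maybe.just (Rep.complete u p)

  adjacent⇒≢ : ∀ {u x c} → rep u x ≡ just c → u ≢ x
  adjacent⇒≢ {u} p refl = contradiction (trans (≡-sym (loopless G u)) (Rep.sound u p)) λ ()

  differs : Fin n → Fin n → ℕ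
  differs u v = count (λ x → differ? (rep u x) (rep v x))

  -- Every color of the union lies in the palette of some `x`, so the distinct colors are no more
  -- than all palettes together; the palette inequality is then summed over `x`.
  cardCNUnion+missed≤ : ∀ u v →
    cardCNUnion G u v + ∑[ x < n ] (missing (rep u x) * missing (rep v x)) ≤ differs u v + n
  cardCNUnion+missed≤ u v = begin
    length colors + sum missed              ≤⟨ +-monoˡ-≤ (sum missed) (Unique-⊆⇒length≤ (deduplicate-! _≟_ _) covered) ⟩
    length (concat (tabulate K)) + sum missed ≡⟨ cong (_+ sum missed) (length-concat-tabulate K) ⟩
    ∑[ x < n ] length (K x) + sum missed    ≡⟨ ≡-sym (∑-distrib-+ (length ∘ K) missed) ⟩
    ∑[ x < n ] (length (K x) + missed x)    ≤⟨ sum-mono (λ x → proj₂ (proj₂ (palette (rep u x) (rep v x)))) ⟩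
    ∑[ x < n ] (ι (differ? (rep u x) (rep v x)) + 1)
      ≡⟨ ∑-distrib-+-const (λ x → ι (differ? (rep u x) (rep v x))) 1 ⟩
    differs u v + n * 1                     ≡⟨ cong (differs u v +_) (*-identityʳ n) ⟩
    differs u v + n                         ∎
    where
    open ≤-Reasoning
    colors : List ℕ
    colors = deduplicate _≟_ (CN G u ++ CN G v)
    missed : Fin n → ℕ
    missed x = missing (rep u x) * missing (rep v x)
    K : Fin n → List ℕ
    K x = proj₁ (palette (rep u x) (rep v x))
    used : All (λ c → ∃[ x ] (rep u x ≡ just c ⊎ rep v x ≡ just c)) (CN G u ++ CN G v)
    used = All-++⁺ (mapAll (λ { (x , p) → x , inj₁ p }) (CN-rep u))
                   (mapAll (λ { (x , p) → x , inj₂ p }) (CN-rep v))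
    covered : ∀ {c} → c ∈ colors → c ∈ concat (tabulate K)
    covered c∈ =
      let x , p = lookupAll used (∈-deduplicate⁻ _≟_ _ c∈)
      in ∈-concat⁺′ (proj₁ (proj₂ (palette (rep u x) (rep v x))) p) (∈-tabulate⁺ x)

  -- Among the edges at x in the color of ux, at most one is chosen at x; the other ends are missed by x.
  agree-count≤ : ∀ u x → count (λ v → agree? (rep u x) (rep v x)) ≤ ∑[ v < n ] missing (rep x v) + 1
  agree-count≤ u x = begin
    count (λ v → agree? (rep u x) (rep v x))
      ≤⟨ sum-mono pointwise ⟩
    ∑[ v < n ] (missing (rep x v) + ι (agree? (rep u x) (rep x v)))
      ≡⟨ ∑-distrib-+ (λ v → missing (rep x v)) (λ v → ι (agree? (rep u x) (rep x v))) ⟩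
    ∑[ v < n ] missing (rep x v) + count (λ v → agree? (rep u x) (rep x v))
      ≤⟨ +-monoʳ-≤ _ (count≤1 _ same) ⟩
    ∑[ v < n ] missing (rep x v) + 1 ∎
    where
    open ≤-Reasoning
    agree⇒ : ∀ {m m′} → Agree m m′ → ∃[ c ] (m ≡ just c × m′ ≡ just c)
    agree⇒ agree = _ , refl , refl
    same : Subsingleton (λ v → Agree (rep u x) (rep x v))
    same p q with agree⇒ p | agree⇒ q
    ... | c , e , e₁ | d , e′ , e₂ = Rep.injective x e₁ (trans e₂ (trans (≡-sym e′) e))
    pointwise : ∀ v → ι (agree? (rep u x) (rep v x)) ≤ missing (rep x v) + ι (agree? (rep u x) (rep x v))
    pointwise v with agree? (rep u x) (rep v x)
    ... | no  _ = z≤n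
    ... | yes p with agree⇒ p
    ...   | c , e , e₁ = chosen (rep x v) refl
      where
      chosen : ∀ m → rep x v ≡ m → 1 ≤ missing m + ι (agree? (rep u x) m)
      chosen nothing  _ = s≤s z≤n
      chosen (just d) q = ι-yes (agree? (rep u x) (just d)) (subst (Agree (rep u x)) (trans e₁′ q) p)
        where
        -- The edge is chosen at both ends here, so both entries are its color in `G`.
        e₁′ : rep v x ≡ rep x v
        e₁′ = trans e₁ (trans (≡-sym (trans (sym G x v) (Rep.sound v e₁))) (trans (Rep.sound x q) (≡-sym q)))

  -- Rainbow 4-cycles with two fixed opposite corners.

  RainbowC4s : ℕ → Set
  RainbowC4s k = ∃[ cs ] (length cs ≡ k × All (RainbowC4 G) cs × AllPairs (λ p q → ¬ SameCycle p q) cs)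

  -- Of the eight symmetries, six replace `u` by another corner and the reflection fixing `u`
  -- replaces `x` by `y`; all seven contradict the distinctness of the corners. The identity would
  -- make the two fourth corners equal.
  fan-distinct : ∀ {u x v ys} → All (λ y → RainbowC4 G (u , x , v , y)) ys → Unique ys →
    AllPairs (λ p q → ¬ SameCycle p q) (map (λ y → u , x , v , y) ys)
  fan-distinct []       []           = []
  fan-distinct {u} {x} {v} {y ∷ _} ((u≢x , u≢v , u≢y , x≢v , x≢y , v≢y , _) ∷ rs) (y∉ys ∷ ys!) =
    All-map⁺ (mapAll distinct y∉ys) ∷ fan-distinct rs ys!
    where
    distinct : ∀ {y′} → y ≢ y′ → ¬ SameCycle (u , x , v , y) (u , x , v , y′)
    distinct y≢y′ (inj₁ refl) = y≢y′ refl
    distinct y≢y′ (inj₂ (inj₁ refl)) = u≢x refl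
    distinct y≢y′ (inj₂ (inj₂ (inj₁ refl))) = u≢v refl
    distinct y≢y′ (inj₂ (inj₂ (inj₂ (inj₁ refl)))) = u≢y refl
    distinct y≢y′ (inj₂ (inj₂ (inj₂ (inj₂ (inj₁ refl))))) = x≢y refl
    distinct y≢y′ (inj₂ (inj₂ (inj₂ (inj₂ (inj₂ (inj₁ refl)))))) = u≢y refl
    distinct y≢y′ (inj₂ (inj₂ (inj₂ (inj₂ (inj₂ (inj₂ (inj₁ refl))))))) = u≢v refl
    distinct y≢y′ (inj₂ (inj₂ (inj₂ (inj₂ (inj₂ (inj₂ (inj₂ refl))))))) = u≢x refl

  differ⇒ : ∀ {m m′} → Differ m m′ → ∃[ c ] ∃[ d ] (m ≡ just c × m′ ≡ just d × c ≢ d)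
  differ⇒ (differ c≢d) = _ , _ , refl , refl , c≢d

  -- Fix one x with differing colors c, d to u, v; each of the colors c, d excludes
  -- at most one y as seen from u and at most one as seen from v.
  differs⇒RainbowC4s : ∀ {k} u v → 4 + k ≤ differs u v → RainbowC4s k
  differs⇒RainbowC4s {k} u v many with select _ 1 (≤-trans (s≤s z≤n) many)
  ... | x ∷ [] , _ , dx ∷ [] , _ with differ⇒ dx
  ...   | c , d , ux≡c , vx≡d , c≢d =
    let ys , len , good , ys! = select _ k
          (count-avoid _ (λ y → rep v y ≟ᵐ just d) (Rep.injective v)
          (count-avoid _ (λ y → rep v y ≟ᵐ just c) (Rep.injective v)
          (count-avoid _ (λ y → rep u y ≟ᵐ just d) (Rep.injective u)
          (count-avoid _ (λ y → rep u y ≟ᵐ just c) (Rep.injective u) many))))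
        rainbow = mapAll (λ { ((((p , q₁) , q₂) , q₃) , q₄) → cycle p q₁ q₂ q₃ q₄ }) good
    in map (λ y → u , x , v , y) ys , trans (length-map _ ys) len , All-map⁺ rainbow , fan-distinct rainbow ys!
    where
    cycle : ∀ {y} → Differ (rep u y) (rep v y) → rep u y ≢ just c → rep u y ≢ just d →
      rep v y ≢ just c → rep v y ≢ just d → RainbowC4 G (u , x , v , y)
    cycle dy uy≢c uy≢d vy≢c vy≢d with differ⇒ dy
    ... | c′ , d′ , uy≡c′ , vy≡d′ , c′≢d′ =
        adjacent⇒≢ ux≡c
      -- `u ≢ v` is not assumed: it follows because the edges from `u` and `v` to `x` have different
      -- colors.
      , (λ { refl → c≢d (just-injective (trans (≡-sym ux≡c) vx≡d)) })
      , adjacent⇒≢ uy≡c′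
      , adjacent⇒≢ vx≡d ∘ ≡-sym
      -- `x` itself is already discarded when color `c` is forbidden at `u`, so no fifth exclusion
      -- is spent on it.
      , (λ { refl → uy≢c ux≡c })
      , adjacent⇒≢ vy≡d′
      , c , d , d′ , c′
      , Rep.sound u ux≡c
      , trans (sym G x v) (Rep.sound v vx≡d)
      , Rep.sound v vy≡d′
      , trans (sym G _ u) (Rep.sound u uy≡c′)
      -- Of the six color inequalities, the first and the last come from the differences at `x` and
      -- at `y`; the middle four are the four exclusions.
      , c≢d
      , (λ { refl → vy≢c vy≡d′ })
      , (λ { refl → uy≢c uy≡c′ })
      , (λ { refl → vy≢d vy≡d′ })
      , (λ { refl → uy≢d uy≡c′ })
      , c′≢d′ ∘ ≡-sym

  -- The bound on the order and its contradiction.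

  order≤ : ∀ k → .{{_ : NonZero n}} → (∀ u v → u ≢ v → cardCNUnion G u v ≥ n ∸ 1) →
    (∀ u v → differs u v ≤ 3 + k) → n ≤ 11 * (3 + k) + 20
  order≤ k union few = Counting.n≤11g+20 rep (3 + k) few missed agree-count≤
    where
    open ≤-Reasoning
    -- The shortfall from `n` to `n ∸ 1` in the union hypothesis is what turns the bound `3 + k`
    -- into its successor.
    missed : ∀ u v → u ≢ v → ∑[ x < n ] (missing (rep u x) * missing (rep v x)) ≤ suc (3 + k)
    missed u v u≢v = +-cancelˡ-≤ (n ∸ 1) _ _ (begin
      n ∸ 1 + s                  ≤⟨ +-monoˡ-≤ s (union u v u≢v) ⟩
      cardCNUnion G u v + s      ≤⟨ cardCNUnion+missed≤ u v ⟩
      differs u v + n            ≤⟨ +-mono-≤ (few u v) (m≤n+m∸n n 1) ⟩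
      3 + k + suc (n ∸ 1)        ≡⟨ +-comm (3 + k) (suc (n ∸ 1)) ⟩
      suc (n ∸ 1 + (3 + k))      ≡⟨ ≡-sym (+-suc (n ∸ 1) (3 + k)) ⟩
      n ∸ 1 + suc (3 + k)        ∎)
      where
      s : ℕ
      s = ∑[ x < n ] (missing (rep u x) * missing (rep v x))

theorem6 : (k n : ℕ) → 1 ≤ k → 105 * k ≤ n + 24 → (G : ECGraph n) →
    (∀ (u v : Fin n) → u ≢ v → cardCNUnion G u v ≥ n ∸ 1) →
    ∃[ cs ] (length cs ≡ k × All (RainbowC4 G) cs
    × AllPairs (λ p q → ¬ SameCycle p q) cs)
theorem6 k n 1≤k 105k≤n+24 G union with any? (λ u → any? (λ v → 4 + k ≤? Representatives.differs G u v))
... | yes (u , v , many) = Representatives.differs⇒RainbowC4s G u v many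
... | no  few            = contradiction large (<⇒≱ small)
  where
  open ≤-Reasoning
  -- 81 = 105 - 24, the case `k = 1` of the hypothesis; it supplies the positivity of `n` needed for
  -- dividing by n².
  81≤n : 81 ≤ n
  81≤n = +-cancelʳ-≤ 24 81 n (≤-trans (*-monoʳ-≤ 105 1≤k) 105k≤n+24)
  n≤ : n ≤ 11 * (3 + k) + 20
  n≤ = Representatives.order≤ G k {{>-nonZero (≤-trans (s≤s z≤n) 81≤n)}} union
         (λ u v → ≤-pred (≰⇒> (λ many → few (u , v , many))))
  expand : ∀ k → 11 * (3 + k) + 20 + 24 ≡ 11 * k + 77
  expand = solve-∀
  split : ∀ k → 11 * k + 94 * k ≡ 105 * k
  split = solve-∀
  -- The bound reads n ≤ 11k + 53; set against 105k ≤ n + 24 it leaves 94k ≤ 77, which fails already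
  -- for `k = 1`.
  large : 94 * k ≤ 77
  large = +-cancelˡ-≤ (11 * k) _ _ (begin
    11 * k + 94 * k          ≡⟨ split k ⟩
    105 * k                  ≤⟨ 105k≤n+24 ⟩
    n + 24                   ≤⟨ +-monoˡ-≤ 24 n≤ ⟩
    11 * (3 + k) + 20 + 24   ≡⟨ expand k ⟩
    11 * k + 77              ∎)
  small : 77 < 94 * k
  small = ≤-trans (m≤m+n 78 16) (*-monoʳ-≤ 94 1≤k)
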